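{- Let $Q$ be a finite, connected, graded poset and let $k\ge 1$ be an integer. Then $$\mathcal{N}_{[k]\times Q}(x)=\sum_{I}\mathcal{N}_I^k(x),$$ where $I$ runs over all ideals of $Q$.
   Context: A finite poset is graded if all its maximal chains have the same length. $[k]$ denotes the chain with $k$ elements, and $[k]\times Q$ is the product poset with the componentwise order. For a finite poset $R$, $\mathcal{N}_R(x):=\sum_A x^{|A|}$, where $A$ runs over all antichains of $R$ (including the empty one). An ideal of $Q$ is a subset $I\subseteq Q$ such that $x\le y$ in $Q$ and $y\in I$ imply $x\in I$ (the empty set is an ideal). For an ideal $I$, $\max(I)$ denotes the set of maximal elements of $I$. For an ideal $I$ of $Q$ and an integer $k\ge 1$, define $$\mathcal{N}_I^k(x):=\sum_{I_1\subseteq\cdots\subseteq I_{k-1}\subseteq I_k=I} x^{\sum_{j=1}^k \#(\max(I_j)\setminus I_{j-1})},$$ where the sum runs over all increasing $(k-1)$-sequences $I_1\subseteq\cdots\subseteq I_{k-1}$ of ideals of $Q$ contained in $I$, with the conventions $I_k:=I$ and $I_0:=\emptyset$. -}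

module Defs where

open import Data.Bool using (Bool; true; false)
open import Data.Fin using (Fin)
import Data.Fin.Properties as Fin
open import Data.Fin.Subset using (Subset; _∈_; _⊆_; _─_; ∣_∣; ⊥)
open import Data.Fin.Subset.Properties using (_∈?_; _⊆?_)
open import Data.List as List using (List; []; _∷_; filter; foldr; replicate; cartesianProductWith)
open import Data.Nat using (ℕ; zero; suc; pred; _+_; _*_; NonZero)
open import Data.Product using (_×_)
open import Data.Product.Function.NonDependent.Setoid using (_×-inverse_)
open import Data.Product.Relation.Binary.Pointwise.NonDependent using (×-poset; ×-decidable; Pointwise-≡↔≡)
open import Data.Sum using (_⊎_)
open import Data.Vec as Vec using (Vec; []; _∷_; tabulate; _∷ʳ_)
open import Data.Vec.Relation.Unary.Linked using (Linked; linked?)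
open import Function.Bundles using (Inverse)
open import Function.Construct.Composition using (inverse)
open import Function.Construct.Identity using () renaming (inverse to id-inverse)
open import Function.Construct.Symmetry using () renaming (inverse to sym-inverse)
open import Level using (_⊔_; 0ℓ) renaming (suc to lsuc)
open import Relation.Binary.Bundles using (Poset; DecPoset; DecTotalOrder)
open import Relation.Binary.Construct.Closure.Equivalence using (EqClosure)
open import Relation.Binary.PropositionalEquality using (_≡_; setoid)
open import Relation.Nullary using (Dec; does)
open import Relation.Nullary.Decidable using (_×-dec_; _→-dec_)
open import Relation.Unary using (Decidable)

------------------------------------------------------------------------
-- Polynomials in one variable x with coefficients in ℕ: the list
-- a₀ ∷ a₁ ∷ … ∷ [] stands for a₀ + a₁ x + …, and trailing zeros are
-- ignored by _≈ₚ_.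

Poly : Set
Poly = List ℕ

coeff : Poly → ℕ → ℕ
coeff []      _       = 0
coeff (a ∷ _) zero    = a
coeff (_ ∷ p) (suc m) = coeff p m

infix 4 _≈ₚ_

_≈ₚ_ : Poly → Poly → Set
p ≈ₚ q = ∀ m → coeff p m ≡ coeff q m

infixl 6 _+ₚ_

_+ₚ_ : Poly → Poly → Poly
[]      +ₚ q       = q
(a ∷ p) +ₚ []      = a ∷ p
(a ∷ p) +ₚ (b ∷ q) = a + b ∷ p +ₚ q

x^_ : ℕ → Poly
x^ zero  = 1 ∷ []
x^ suc m = 0 ∷ x^ m

sumOver : ∀ {a} {A : Set a} → List A → (A → Poly) → Poly
sumOver as f = foldr (λ a p → f a +ₚ p) [] as

infix 3 sumOver
syntax sumOver as (λ a → p) = ∑[ a ← as ] p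

------------------------------------------------------------------------

-- All vectors of length m with entries taken from as.
tuples : ∀ {a} {A : Set a} → List A → ∀ m → List (Vec A m)
tuples as zero    = [] ∷ []
tuples as (suc m) = cartesianProductWith _∷_ as (tuples as m)

allSubsets : ∀ n → List (Subset n)
allSubsets n = tuples (false ∷ true ∷ []) n

------------------------------------------------------------------------

-- Finiteness is a bijection with some Fin size; as usual for finite
-- objects, the order is decidable.
record FinitePoset c ℓ₁ ℓ₂ : Set (lsuc (c ⊔ ℓ₁ ⊔ ℓ₂)) where
  field
    decPoset : DecPoset c ℓ₁ ℓ₂
    size     : ℕ
    enum     : Inverse (DecPoset.Eq.setoid decPoset) (setoid (Fin size))

  open DecPoset decPoset public

  element : Fin size → Carrier
  element = Inverse.from enum

  infix 4 _≼_ _≼?_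

  -- The order transported to Fin size.  Subsets of the poset are
  -- represented by Subset size, an element x being represented by its
  -- index Inverse.to enum x.
  _≼_ : Fin size → Fin size → Set ℓ₂
  i ≼ j = element i ≤ element j

  _≼?_ : ∀ i j → Dec (i ≼ j)
  i ≼? j = element i ≤? element j

[_]ᶜ : ℕ → FinitePoset 0ℓ 0ℓ 0ℓ
[ k ]ᶜ = record
  { decPoset = DecTotalOrder.decPoset (Fin.≤-decTotalOrder k)
  ; size     = k
  ; enum     = id-inverse (setoid (Fin k))
  }

infixr 2 _×ᶠ_

_×ᶠ_ : ∀ {c₁ ℓ₁ ℓ₂ c₂ ℓ₃ ℓ₄} → FinitePoset c₁ ℓ₁ ℓ₂ → FinitePoset c₂ ℓ₃ ℓ₄ →
       FinitePoset (c₁ ⊔ c₂) (ℓ₁ ⊔ ℓ₃) (ℓ₂ ⊔ ℓ₄)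
P ×ᶠ Q = record
  { decPoset = record
    { isDecPartialOrder = record
      { isPartialOrder = Poset.isPartialOrder (×-poset P.poset Q.poset)
      ; _≟_            = ×-decidable P._≟_ Q._≟_
      ; _≤?_           = ×-decidable P._≤?_ Q._≤?_
      }
    }
  ; size = P.size * Q.size
  ; enum = inverse (P.enum ×-inverse Q.enum)
                   (inverse Pointwise-≡↔≡ (sym-inverse Fin.*↔×))
  }
  where
  module P = FinitePoset P
  module Q = FinitePoset Q

------------------------------------------------------------------------

module _ {c ℓ₁ ℓ₂} (Q : FinitePoset c ℓ₁ ℓ₂) where

  open FinitePoset Q

  -- Connectedness of the comparability graph (equivalently, of the
  -- Hasse diagram).
  Connected : Set (c ⊔ ℓ₂)
  Connected = ∀ x y → EqClosure _≤_ x y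

  IsChain : Subset size → Set ℓ₂
  IsChain C = ∀ i j → i ∈ C → j ∈ C → i ≼ j ⊎ j ≼ i

  IsMaximalChain : Subset size → Set ℓ₂
  IsMaximalChain C = IsChain C × (∀ D → IsChain D → C ⊆ D → D ⊆ C)

  -- Chains are compared by number of elements, which is the same as
  -- comparing lengths whether or not the length is taken to be ∣ C ∣ - 1.
  Graded : Set ℓ₂
  Graded = ∀ C D → IsMaximalChain C → IsMaximalChain D → ∣ C ∣ ≡ ∣ D ∣

  IsAntichain : Subset size → Set ℓ₂
  IsAntichain A = ∀ i j → i ∈ A → j ∈ A → i ≼ j → i ≡ j

  isAntichain? : Decidable IsAntichain
  isAntichain? A = Fin.all? λ i → Fin.all? λ j →
    (i ∈? A) →-dec (j ∈? A) →-dec (i ≼? j) →-dec (i Fin.≟ j)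

  antichains : List (Subset size)
  antichains = filter isAntichain? (allSubsets size)

  𝒩 : Poly
  𝒩 = ∑[ A ← antichains ] x^ ∣ A ∣

  IsIdeal : Subset size → Set ℓ₂
  IsIdeal I = ∀ i j → i ≼ j → j ∈ I → i ∈ I

  isIdeal? : Decidable IsIdeal
  isIdeal? I = Fin.all? λ i → Fin.all? λ j →
    (i ≼? j) →-dec (j ∈? I) →-dec (i ∈? I)

  ideals : List (Subset size)
  ideals = filter isIdeal? (allSubsets size)

  IsMaximalIn : Subset size → Fin size → Set ℓ₂
  IsMaximalIn I i = i ∈ I × (∀ j → j ∈ I → i ≼ j → i ≡ j)

  isMaximalIn? : ∀ I → Decidable (IsMaximalIn I)
  isMaximalIn? I i = (i ∈? I) ×-dec
    Fin.all? λ j → (j ∈? I) →-dec (i ≼? j) →-dec (i Fin.≟ j)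

  max : Subset size → Subset size
  max I = tabulate λ i → does (isMaximalIn? I i)

  -- exponentFrom I₀ (I₁ ∷ … ∷ Iₖ ∷ []) = Σⱼ #(max Iⱼ ∖ Iⱼ₋₁)
  exponentFrom : ∀ {m} → Subset size → Vec (Subset size) m → ℕ
  exponentFrom I₀ []       = 0
  exponentFrom I₀ (I ∷ Is) = ∣ max I ─ I₀ ∣ + exponentFrom I Is

  -- The vectors (I₁, …, Iₖ₋₁) of ideals with I₁ ⊆ ⋯ ⊆ Iₖ₋₁ ⊆ I.
  idealSequences : (k : ℕ) .{{_ : NonZero k}} → Subset size →
                   List (Vec (Subset size) (pred k))
  idealSequences k I =
    filter (λ Is → linked? _⊆?_ (Is ∷ʳ I)) (tuples ideals (pred k))

  𝒩ᴵ : (k : ℕ) .{{_ : NonZero k}} → Subset size → Poly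
  𝒩ᴵ k I = ∑[ Is ← idealSequences k I ] x^ exponentFrom ⊥ (Is ∷ʳ I)

{-# OPTIONS --safe #-}

-- An antichain A of [k] × Q amounts to its layers B₁, …, B_k in Q, listed from the top
-- element of [k] downwards: A is an antichain iff every B_j is one and no element of
-- B_j lies below an element of B_i with i < j.  Such layers correspond to chains
-- I₁ ⊆ ⋯ ⊆ I_k of ideals: inductively, for a fixed ideal I₀, the assignments
-- I ↦ max I ∖ I₀ and B ↦ I₀ ∪ ↓B are mutually inverse between the ideals containing I₀
-- and the antichains disjoint from I₀.  Since |A| = Σⱼ |Bⱼ|, the exponents agree.
module Submission where

open import Defs
open import Data.Bool using (true; false)
open import Data.Fin as Fin using (Fin; zero; suc; combine; opposite; inject₁; fromℕ)
open import Data.Fin.Induction using (po-noetherian)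
open import Data.Fin.Properties as Fin
  using (combine-injective; combine-surjective; remQuot-combine; opposite-prop; opposite-involutive)
open import Data.Fin.Subset using (Subset; _∈_; _∉_; _⊆_; _─_; ∣_∣; ⊥; inside; outside)
open import Data.Fin.Subset.Properties
  using (_∈?_; _⊆?_; ⊆-antisym; x∈p∧x∉q⇒x∈p─q; p─q⊆p; ∉⊥; ⊥⊆)
open import Data.List using (List; []; _∷_; _++_; map; concatMap)
open import Data.List.Membership.Propositional using (find) renaming (_∈_ to _∈ₗ_)
open import Data.List.Membership.Propositional.Properties
  using (∈-map⁺; ∈-map⁻; ∈-filter⁺; ∈-filter⁻; ∈-concatMap⁺; ∈-concatMap⁻;
         ∈-cartesianProductWith⁺; ∈-cartesianProductWith⁻)
open import Data.List.Membership.Propositional.Properties.WithK using (unique∧set⇒bag)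
open import Data.List.Properties using (map-∘; map-id-local)
open import Data.List.Relation.Binary.BagAndSetEquality using (∼bag⇒↭)
open import Data.List.Relation.Binary.Permutation.Propositional using (_↭_)
import Data.List.Relation.Binary.Permutation.Propositional.Properties as ↭
import Data.List.Relation.Unary.All as All
import Data.List.Relation.Unary.All.Properties as All
import Data.List.Relation.Unary.AllPairs as AllPairs
import Data.List.Relation.Unary.AllPairs.Properties as AllPairs
import Data.List.Relation.Unary.Any as Any
open import Data.List.Relation.Unary.Unique.Propositional using (Unique)
import Data.List.Relation.Unary.Unique.Propositional.Properties as Unique
open import Data.Nat using (ℕ; zero; suc; _+_; _*_; NonZero; z≤n; s≤s; s≤s⁻¹)
open import Data.Nat.ListAction using (sum)
open import Data.Nat.ListAction.Properties using (sum-↭)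
open import Data.Nat.Properties using (+-assoc; +-comm; +-identityʳ; ∸-monoʳ-≤)
open import Data.Product using (_×_; _,_; ∃; proj₁; proj₂)
open import Data.Sum using (_⊎_; inj₁; inj₂; [_,_]′)
open import Data.Vec as Vec
  using (Vec; []; _∷_; lookup; tabulate; concat; group; reverse; _∷ʳ_; initLast)
open import Data.Vec.Properties
  using (∷-injective; ∷ʳ-injectiveˡ; ∷ʳ-injectiveʳ; ++-injective; lookup-concat; lookup∘tabulate;
         []=⇒lookup; lookup⇒[]=; reverse-∷; reverse-involutive)
open import Data.Vec.Relation.Unary.All as VAll using ([]; _∷_) renaming (All to VAll)
open import Data.Vec.Relation.Unary.Linked using (Linked; linked?; []; [-]; _∷_)
open import Function using (_∘_; Inverse; mk⇔)
open import Induction.WellFounded using (Acc; acc)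
open import Relation.Binary.PropositionalEquality
open import Relation.Binary.Structures using (IsPartialOrder)
open import Relation.Nullary using (yes; no; does; ¬_; contradiction)
open import Relation.Nullary.Decidable using (dec-true; _×-dec_; _⊎-dec_; ¬?)
open import Relation.Unary using (Decidable)

-- Sums of polynomials

coeff-+ₚ : ∀ p q m → coeff (p +ₚ q) m ≡ coeff p m + coeff q m
coeff-+ₚ []      q       m       = refl
coeff-+ₚ (a ∷ p) []      m       = sym (+-identityʳ _)
coeff-+ₚ (a ∷ p) (b ∷ q) zero    = refl
coeff-+ₚ (a ∷ p) (b ∷ q) (suc m) = coeff-+ₚ p q m

module _ {a} {A : Set a} where

  coeff-sumOver : ∀ (as : List A) f m → coeff (sumOver as f) m ≡ sum (map (λ a → coeff (f a) m) as)
  coeff-sumOver []       f m = refl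
  coeff-sumOver (a ∷ as) f m =
    trans (coeff-+ₚ (f a) (sumOver as f) m) (cong (coeff (f a) m +_) (coeff-sumOver as f m))

  sumOver-++ : ∀ (as bs : List A) f → sumOver (as ++ bs) f ≈ₚ sumOver as f +ₚ sumOver bs f
  sumOver-++ []       bs f m = refl
  sumOver-++ (a ∷ as) bs f m = begin
    coeff (f a +ₚ sumOver (as ++ bs) f) m
      ≡⟨ coeff-+ₚ (f a) _ m ⟩
    coeff (f a) m + coeff (sumOver (as ++ bs) f) m
      ≡⟨ cong (coeff (f a) m +_) (trans (sumOver-++ as bs f m) (coeff-+ₚ (sumOver as f) _ m)) ⟩
    coeff (f a) m + (coeff (sumOver as f) m + coeff (sumOver bs f) m)
      ≡⟨ +-assoc (coeff (f a) m) _ _ ⟨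
    coeff (f a) m + coeff (sumOver as f) m + coeff (sumOver bs f) m
      ≡⟨ cong (_+ coeff (sumOver bs f) m) (coeff-+ₚ (f a) _ m) ⟨
    coeff (f a +ₚ sumOver as f) m + coeff (sumOver bs f) m
      ≡⟨ coeff-+ₚ (f a +ₚ sumOver as f) _ m ⟨
    coeff (f a +ₚ sumOver as f +ₚ sumOver bs f) m ∎
    where open ≡-Reasoning

  -- Coefficientwise the sum of polynomials is a sum of natural numbers, which does not depend on
  -- the order of its terms.
  sumOver-↭ : ∀ {as bs : List A} f → as ↭ bs → sumOver as f ≈ₚ sumOver bs f
  sumOver-↭ {as} {bs} f as↭bs m = begin
    coeff (sumOver as f) m               ≡⟨ coeff-sumOver as f m ⟩
    sum (map (λ a → coeff (f a) m) as)   ≡⟨ sum-↭ (↭.map⁺ _ as↭bs) ⟩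
    sum (map (λ a → coeff (f a) m) bs)   ≡⟨ coeff-sumOver bs f m ⟨
    coeff (sumOver bs f) m               ∎
    where open ≡-Reasoning

  sumOver-cong : ∀ (as : List A) {f g} → (∀ a → f a ≡ g a) → sumOver as f ≡ sumOver as g
  sumOver-cong []       f≗g = refl
  sumOver-cong (a ∷ as) f≗g = cong₂ _+ₚ_ (f≗g a) (sumOver-cong as f≗g)

  sumOver-map : ∀ {b} {B : Set b} (h : B → A) bs f → sumOver (map h bs) f ≡ sumOver bs (f ∘ h)
  sumOver-map h []       f = refl
  sumOver-map h (b ∷ bs) f = cong (f (h b) +ₚ_) (sumOver-map h bs f)

  sumOver-concatMap : ∀ {b} {B : Set b} (h : B → List A) bs f →
                      sumOver (concatMap h bs) f ≈ₚ sumOver bs (λ b → sumOver (h b) f)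
  sumOver-concatMap h []       f m = refl
  sumOver-concatMap h (b ∷ bs) f m = begin
    coeff (sumOver (h b ++ concatMap h bs) f) m
      ≡⟨ sumOver-++ (h b) _ f m ⟩
    coeff (sumOver (h b) f +ₚ sumOver (concatMap h bs) f) m
      ≡⟨ coeff-+ₚ (sumOver (h b) f) _ m ⟩
    coeff (sumOver (h b) f) m + coeff (sumOver (concatMap h bs) f) m
      ≡⟨ cong (coeff (sumOver (h b) f) m +_) (sumOver-concatMap h bs f m) ⟩
    coeff (sumOver (h b) f) m + coeff (sumOver bs (λ b → sumOver (h b) f)) m
      ≡⟨ coeff-+ₚ (sumOver (h b) f) _ m ⟨
    coeff (sumOver (h b) f +ₚ sumOver bs (λ b → sumOver (h b) f)) m ∎
    where open ≡-Reasoning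

-- Lists in bijection, and lists of tuples

module _ {a b} {A : Set a} {B : Set b} where

  -- Duplicate-free lists with the same members are permutations of each other. That `map f as` has
  -- no duplicates follows because mapping `g` over it gives back `as`.
  bijection⇒↭ : ∀ {as : List A} {bs : List B} (f : A → B) (g : B → A) → Unique as → Unique bs →
                (∀ {x} → x ∈ₗ as → f x ∈ₗ bs × g (f x) ≡ x) →
                (∀ {y} → y ∈ₗ bs → g y ∈ₗ as × f (g y) ≡ y) →
                map f as ↭ bs
  bijection⇒↭ {as} {bs} f g as! bs! to from =
    ∼bag⇒↭ (unique∧set⇒bag fas! bs! (mk⇔ ⊆bs bs⊆))
    where
    fas! : Unique (map f as)
    fas! = Unique.map⁻ {f = g} (subst Unique
      (trans (sym (map-id-local (All.tabulate (proj₂ ∘ to)))) (map-∘ as)) as!)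

    ⊆bs : ∀ {y} → y ∈ₗ map f as → y ∈ₗ bs
    ⊆bs y∈ with x , x∈as , refl ← ∈-map⁻ f y∈ = proj₁ (to x∈as)

    bs⊆ : ∀ {y} → y ∈ₗ bs → y ∈ₗ map f as
    bs⊆ y∈ = subst (_∈ₗ map f as) (proj₂ (from y∈)) (∈-map⁺ f (proj₁ (from y∈)))

module _ {a} {A : Set a} {as : List A} where

  ∈-tuples⁺ : ∀ {m} {xs : Vec A m} → VAll (_∈ₗ as) xs → xs ∈ₗ tuples as m
  ∈-tuples⁺ []         = Any.here refl
  ∈-tuples⁺ (px ∷ pxs) = ∈-cartesianProductWith⁺ _∷_ px (∈-tuples⁺ pxs)

  ∈-tuples⁻ : ∀ {m} {xs : Vec A m} → xs ∈ₗ tuples as m → VAll (_∈ₗ as) xs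
  ∈-tuples⁻ {zero}  {[]} _  = []
  ∈-tuples⁻ {suc m} xs∈
    with _ , _ , x∈ , xs∈ , refl ← ∈-cartesianProductWith⁻ _∷_ as (tuples as m) xs∈
    = x∈ ∷ ∈-tuples⁻ xs∈

  tuples-unique : Unique as → ∀ m → Unique (tuples as m)
  tuples-unique as! zero    = All.[] AllPairs.∷ AllPairs.[]
  tuples-unique as! (suc m) = Unique.cartesianProductWith⁺ _∷_ ∷-injective as! (tuples-unique as! m)

∈-allSubsets : ∀ {n} (p : Subset n) → p ∈ₗ allSubsets n
∈-allSubsets p = ∈-tuples⁺ (VAll.universal (λ { false → Any.here refl ; true → Any.there (Any.here refl) }) p)

allSubsets-unique : ∀ n → Unique (allSubsets n)
allSubsets-unique = tuples-unique (((λ ()) All.∷ All.[]) AllPairs.∷ All.[] AllPairs.∷ AllPairs.[])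

-- Vectors and subsets

module _ {a} {A : Set a} where

  All-∷ʳ⁺ : ∀ {p m x} {P : A → Set p} {xs : Vec A m} → VAll P xs → P x → VAll P (xs ∷ʳ x)
  All-∷ʳ⁺ []         px′ = px′ ∷ []
  All-∷ʳ⁺ (px ∷ pxs) px′ = px ∷ All-∷ʳ⁺ pxs px′

  All-∷ʳ⁻ : ∀ {p m x} {P : A → Set p} {xs : Vec A m} → VAll P (xs ∷ʳ x) → VAll P xs × P x
  All-∷ʳ⁻ {xs = []}     (px ∷ [])  = [] , px
  All-∷ʳ⁻ {xs = x ∷ xs} (px ∷ pxs) with pxs′ , px′ ← All-∷ʳ⁻ pxs = px ∷ pxs′ , px′

  concat-injective : ∀ {m n} (xss yss : Vec (Vec A m) n) → concat xss ≡ concat yss → xss ≡ yss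
  concat-injective []         []         eq = refl
  concat-injective (xs ∷ xss) (ys ∷ yss) eq with xs≡ys , eq′ ← ++-injective xs ys eq =
    cong₂ _∷_ xs≡ys (concat-injective xss yss eq′)

  lookup-∷ʳ-inject₁ : ∀ {n} (xs : Vec A n) x i → lookup (xs ∷ʳ x) (inject₁ i) ≡ lookup xs i
  lookup-∷ʳ-inject₁ (y ∷ xs) x zero    = refl
  lookup-∷ʳ-inject₁ (y ∷ xs) x (suc i) = lookup-∷ʳ-inject₁ xs x i

  lookup-∷ʳ-fromℕ : ∀ {n} (xs : Vec A n) x → lookup (xs ∷ʳ x) (fromℕ n) ≡ x
  lookup-∷ʳ-fromℕ []       x = refl
  lookup-∷ʳ-fromℕ (y ∷ xs) x = lookup-∷ʳ-fromℕ xs x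

  lookup-reverse : ∀ {n} (xs : Vec A n) i → lookup (reverse xs) (opposite i) ≡ lookup xs i
  lookup-reverse (x ∷ xs) i rewrite reverse-∷ x xs with i
  ... | zero  = lookup-∷ʳ-fromℕ (reverse xs) x
  ... | suc i = trans (lookup-∷ʳ-inject₁ (reverse xs) x (opposite i)) (lookup-reverse xs i)

opposite-antitone : ∀ {n} {i j : Fin n} → i Fin.≤ j → opposite j Fin.≤ opposite i
opposite-antitone {n} {i} {j} i≤j rewrite opposite-prop i | opposite-prop j = ∸-monoʳ-≤ n (s≤s i≤j)

opposite-cancel-≤ : ∀ {n} {i j : Fin n} → opposite j Fin.≤ opposite i → i Fin.≤ j
opposite-cancel-≤ {i = i} {j} le =
  subst₂ Fin._≤_ (opposite-involutive i) (opposite-involutive j) (opposite-antitone le)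

∣++∣ : ∀ {m n} (p : Subset m) (q : Subset n) → ∣ p Vec.++ q ∣ ≡ ∣ p ∣ + ∣ q ∣
∣++∣ []            q = refl
∣++∣ (inside  ∷ p) q = cong suc (∣++∣ p q)
∣++∣ (outside ∷ p) q = ∣++∣ p q

-- Reversal before concatenation puts the first layer last; this brings its size back to the front,
-- where `exponentFrom` counts it.
∣concat-∷ʳ∣ : ∀ {m n} (ps : Vec (Subset m) n) p → ∣ concat (ps ∷ʳ p) ∣ ≡ ∣ p ∣ + ∣ concat ps ∣
∣concat-∷ʳ∣ []       p = ∣++∣ p []
∣concat-∷ʳ∣ (q ∷ ps) p = begin
  ∣ q Vec.++ concat (ps ∷ʳ p) ∣       ≡⟨ ∣++∣ q _ ⟩
  ∣ q ∣ + ∣ concat (ps ∷ʳ p) ∣        ≡⟨ cong (∣ q ∣ +_) (∣concat-∷ʳ∣ ps p) ⟩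
  ∣ q ∣ + (∣ p ∣ + ∣ concat ps ∣)     ≡⟨ +-assoc ∣ q ∣ _ _ ⟨
  ∣ q ∣ + ∣ p ∣ + ∣ concat ps ∣       ≡⟨ cong (_+ ∣ concat ps ∣) (+-comm ∣ q ∣ _) ⟩
  ∣ p ∣ + ∣ q ∣ + ∣ concat ps ∣       ≡⟨ +-assoc ∣ p ∣ _ _ ⟩
  ∣ p ∣ + (∣ q ∣ + ∣ concat ps ∣)     ≡⟨ cong (∣ p ∣ +_) (∣++∣ q _) ⟨
  ∣ p ∣ + ∣ q Vec.++ concat ps ∣      ∎
  where open ≡-Reasoning

x∈p─q⇒x∉q : ∀ {n} {p q : Subset n} {x} → x ∈ p ─ q → x ∉ q
x∈p─q⇒x∉q {p = _ ∷ _} {outside ∷ _} (Vec.there x∈) (Vec.there x∈q) = x∈p─q⇒x∉q x∈ x∈q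
x∈p─q⇒x∉q {p = _ ∷ _} {inside ∷ _}  (Vec.there x∈) (Vec.there x∈q) = x∈p─q⇒x∉q x∈ x∈q

module _ {n p} {P : Fin n → Set p} (P? : Decidable P) where

  ∈-tabulate⁺ : ∀ {i} → P i → i ∈ tabulate (does ∘ P?)
  ∈-tabulate⁺ {i} Pi = lookup⇒[]= i _ (trans (lookup∘tabulate _ i) (dec-true (P? i) Pi))

  ∈-tabulate⁻ : ∀ {i} → i ∈ tabulate (does ∘ P?) → P i
  ∈-tabulate⁻ {i} i∈ with P? i | trans (sym (lookup∘tabulate (does ∘ P?) i)) ([]=⇒lookup i∈)
  ... | yes Pi | _ = Pi

-- Ideals and antichains of Q

module _ {c ℓ₁ ℓ₂} (Q : FinitePoset c ℓ₁ ℓ₂) where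

  open FinitePoset Q using (size; enum; _≼_; _≼?_)
  private
    module Q = FinitePoset Q

  -- Antisymmetry in `Q` only yields its setoid equality of elements; the enumeration turns this
  -- into propositional equality of indices.
  ≼-isPartialOrder : IsPartialOrder _≡_ _≼_
  ≼-isPartialOrder = record
    { isPreorder = record
      { isEquivalence = isEquivalence
      ; reflexive     = λ { refl → Q.refl }
      ; trans         = Q.trans
      }
    ; antisym = λ {i} {j} i≼j j≼i → begin
        i                                      ≡⟨ Inverse.strictlyInverseˡ enum i ⟨
        Inverse.to enum (Inverse.from enum i)  ≡⟨ Inverse.to-cong enum (Q.antisym i≼j j≼i) ⟩
        Inverse.to enum (Inverse.from enum j)  ≡⟨ Inverse.strictlyInverseˡ enum j ⟩
        j                                      ∎
    }
    where open ≡-Reasoning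

  private
    module ≼ = IsPartialOrder ≼-isPartialOrder

  -- Climb inside `I` to strictly larger elements until none is left; by finiteness the strict order
  -- has no infinite ascent, so the climb ends at a maximal element.
  below-maximal : ∀ {I i} → i ∈ I → ∃ λ j → IsMaximalIn Q I j × i ≼ j
  below-maximal {I} {i} = go (po-noetherian ≼-isPartialOrder i)
    where
    go : ∀ {i} → Acc _ i → i ∈ I → ∃ λ j → IsMaximalIn Q I j × i ≼ j
    go {i} (acc rs) i∈I
      with Fin.any? (λ j → (j ∈? I) ×-dec (i ≼? j) ×-dec ¬? (i Fin.≟ j))
    ... | yes (j , j∈I , i≼j , i≢j) =
      let m , m-max , j≼m = go (rs (i≼j , i≢j)) j∈I in m , m-max , Q.trans i≼j j≼m
    ... | no none = i , (i∈I , maximal) , Q.refl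
      where
      maximal : ∀ j → j ∈ I → i ≼ j → i ≡ j
      maximal j j∈I i≼j with i Fin.≟ j
      ... | yes i≡j = i≡j
      ... | no  i≢j = contradiction (j , j∈I , i≼j , i≢j) none

  infixl 6 _∪↓_

  private
    ∪↓? : ∀ (I B : Subset size) → Decidable λ i → i ∈ I ⊎ ∃ λ j → j ∈ B × i ≼ j
    ∪↓? I B i = (i ∈? I) ⊎-dec Fin.any? λ j → (j ∈? B) ×-dec (i ≼? j)

  _∪↓_ : Subset size → Subset size → Subset size
  I ∪↓ B = tabulate (does ∘ ∪↓? I B)

  ∈-∪↓⁺ : ∀ {I B i} → (i ∈ I ⊎ ∃ λ j → j ∈ B × i ≼ j) → i ∈ I ∪↓ B
  ∈-∪↓⁺ {I} {B} = ∈-tabulate⁺ (∪↓? I B)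

  ∈-∪↓⁻ : ∀ {I B i} → i ∈ I ∪↓ B → i ∈ I ⊎ ∃ λ j → j ∈ B × i ≼ j
  ∈-∪↓⁻ {I} {B} = ∈-tabulate⁻ (∪↓? I B)

  ∪↓-isIdeal : ∀ {I B} → IsIdeal Q I → IsIdeal Q (I ∪↓ B)
  ∪↓-isIdeal I-ideal i j i≼j j∈ with ∈-∪↓⁻ j∈
  ... | inj₁ j∈I             = ∈-∪↓⁺ (inj₁ (I-ideal i j i≼j j∈I))
  ... | inj₂ (l , l∈B , j≼l) = ∈-∪↓⁺ (inj₂ (l , l∈B , Q.trans i≼j j≼l))

  ∈-max─⁻ : ∀ {I I₀ i} → i ∈ max Q I ─ I₀ → IsMaximalIn Q I i
  ∈-max─⁻ {I} {I₀} i∈ = ∈-tabulate⁻ (isMaximalIn? Q I) (p─q⊆p (max Q I) I₀ i∈)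

  max─-antichain : ∀ I I₀ → IsAntichain Q (max Q I ─ I₀)
  max─-antichain I I₀ i j i∈ j∈ = proj₂ (∈-max─⁻ i∈) j (proj₁ (∈-max─⁻ j∈))

  -- Each element of `I` lies below some maximal element `m` of `I`. If `m` is in `I₀`, so is the
  -- element, since `I₀` is an ideal; otherwise `m` belongs to the generating set.
  ∪↓-max─ : ∀ {I₀ I} → IsIdeal Q I₀ → IsIdeal Q I → I₀ ⊆ I → I₀ ∪↓ (max Q I ─ I₀) ≡ I
  ∪↓-max─ {I₀} {I} I₀-ideal I-ideal I₀⊆I = ⊆-antisym
    (λ i∈ → [ I₀⊆I , (λ (j , j∈ , i≼j) → I-ideal _ j i≼j (proj₁ (∈-max─⁻ j∈))) ]′ (∈-∪↓⁻ i∈))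
    (λ i∈I → ∈-∪↓⁺ (covered i∈I))
    where
    covered : ∀ {i} → i ∈ I → i ∈ I₀ ⊎ ∃ λ j → j ∈ max Q I ─ I₀ × i ≼ j
    covered {i} i∈I with m , m-max , i≼m ← below-maximal i∈I with m ∈? I₀
    ... | yes m∈I₀ = inj₁ (I₀-ideal i m i≼m m∈I₀)
    ... | no  m∉I₀ = inj₂ (m , x∈p∧x∉q⇒x∈p─q (∈-tabulate⁺ (isMaximalIn? Q I) m-max) m∉I₀ , i≼m)

  -- Elements of `I₀ ∪↓ B` outside `I₀` lie below `B`, so the maximal ones among them are in `B`.
  -- Conversely, nothing in `I₀` is above an element of `B`, as `I₀` is an ideal disjoint from `B`,
  -- and the antichain property handles the rest.
  max─-∪↓ : ∀ {I₀ B} → IsIdeal Q I₀ → IsAntichain Q B → (∀ {i} → i ∈ B → i ∉ I₀) →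
            max Q (I₀ ∪↓ B) ─ I₀ ≡ B
  max─-∪↓ {I₀} {B} I₀-ideal B-anti B#I₀ = ⊆-antisym ⊆B B⊆
    where
    I = I₀ ∪↓ B

    ⊆B : max Q I ─ I₀ ⊆ B
    ⊆B i∈ with ∈-max─⁻ i∈
    ... | i∈I , maximal with ∈-∪↓⁻ i∈I
    ...   | inj₁ i∈I₀            = contradiction i∈I₀ (x∈p─q⇒x∉q i∈)
    ...   | inj₂ (j , j∈B , i≼j) =
      subst (_∈ B) (sym (maximal j (∈-∪↓⁺ (inj₂ (j , j∈B , Q.refl))) i≼j)) j∈B

    maximal : ∀ {i} → i ∈ B → ∀ j → j ∈ I → i ≼ j → i ≡ j
    maximal i∈B j j∈I i≼j with ∈-∪↓⁻ j∈I
    ... | inj₁ j∈I₀            = contradiction (I₀-ideal _ j i≼j j∈I₀) (B#I₀ i∈B)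
    -- Here `i ≼ j ≼ l` with `i` and `l` both in the antichain `B`, so `i` equals `l` and `j` is
    -- squeezed between them.
    ... | inj₂ (l , l∈B , j≼l) =
      ≼.antisym i≼j (subst (j ≼_) (sym (B-anti _ l i∈B l∈B (Q.trans i≼j j≼l))) j≼l)

    B⊆ : B ⊆ max Q I ─ I₀
    B⊆ {i} i∈B = x∈p∧x∉q⇒x∈p─q
      (∈-tabulate⁺ (isMaximalIn? Q I) (∈-∪↓⁺ (inj₂ (i , i∈B , Q.refl)) , maximal i∈B)) (B#I₀ i∈B)

  -- Chains of ideals and their layers

  IsIdealChain : ∀ {k} → Vec (Subset size) k → Set ℓ₂
  IsIdealChain Is = VAll (IsIdeal Q) Is × Linked _⊆_ Is

  -- Layer i consists of the elements of [k] × Q with first coordinate opposite i.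
  IsLayered : ∀ {k} → Vec (Subset size) k → Set ℓ₂
  IsLayered Bs = ∀ i j p q → p ∈ lookup Bs i → q ∈ lookup Bs j → j Fin.≤ i → p ≼ q → i ≡ j × p ≡ q

  -- The invariant of the induction along the layers: those still to come are disjoint from the
  -- ideal built so far.
  Avoids : ∀ {k} → Subset size → Vec (Subset size) k → Set
  Avoids I Bs = ∀ i {p} → p ∈ lookup Bs i → p ∉ I

  layers : ∀ {k} → Subset size → Vec (Subset size) k → Vec (Subset size) k
  layers I₀ []       = []
  layers I₀ (I ∷ Is) = (max Q I ─ I₀) ∷ layers I Is

  hulls : ∀ {k} → Subset size → Vec (Subset size) k → Vec (Subset size) k
  hulls I₀ []       = []
  hulls I₀ (B ∷ Bs) = I₀ ∪↓ B ∷ hulls (I₀ ∪↓ B) Bs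

  -- The first layer omits `I₀` by construction; a later one avoids the next ideal by induction, and
  -- that ideal contains `I₀`.
  layers-avoid : ∀ {k I₀} {Is : Vec (Subset size) k} → IsIdealChain (I₀ ∷ Is) → Avoids I₀ (layers I₀ Is)
  layers-avoid {Is = I ∷ Is} _ zero p∈ = x∈p─q⇒x∉q p∈
  layers-avoid {Is = I ∷ Is} (_ ∷ ideals , I₀⊆I ∷ linked) (suc i) p∈ =
    layers-avoid (ideals , linked) i p∈ ∘ I₀⊆I

  layers-layered : ∀ {k I₀} {Is : Vec (Subset size) k} → IsIdealChain (I₀ ∷ Is) → IsLayered (layers I₀ Is)
  layers-layered {I₀ = I₀} {I ∷ Is} _ zero zero p q p∈ q∈ _ p≼q =
    refl , max─-antichain I I₀ p q p∈ q∈ p≼q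
  layers-layered {Is = I ∷ Is} (_ ∷ I-ideal ∷ ideals , _ ∷ linked) (suc i) zero p q p∈ q∈ _ p≼q =
    -- The element `q` of the first layer lies in `I`, hence so does `p` below it; but `p` comes
    -- from a later layer, which avoids `I`.
    contradiction (I-ideal p q p≼q (proj₁ (∈-max─⁻ q∈))) (layers-avoid (I-ideal ∷ ideals , linked) i p∈)
  layers-layered {Is = I ∷ Is} (_ ∷ ideals , _ ∷ linked) (suc i) (suc j) p q p∈ q∈ j≤i p≼q
    with refl , p≡q ← layers-layered (ideals , linked) i j p q p∈ q∈ (s≤s⁻¹ j≤i) p≼q = refl , p≡q

  hulls-layers : ∀ {k I₀} {Is : Vec (Subset size) k} → IsIdealChain (I₀ ∷ Is) → hulls I₀ (layers I₀ Is) ≡ Is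
  hulls-layers {Is = []} _ = refl
  hulls-layers {Is = I ∷ Is} (I₀-ideal ∷ I-ideal ∷ ideals , I₀⊆I ∷ linked)
    -- The rewrite identifies the first hull with `I`, so that the remaining hulls start from the
    -- ideal that the remaining layers were cut from.
    rewrite ∪↓-max─ I₀-ideal I-ideal I₀⊆I = cong (I ∷_) (hulls-layers (I-ideal ∷ ideals , linked))

  -- An element of a later layer is outside `I₀` by assumption, and it cannot lie below `B`, since
  -- layeredness would then put it in the layer with index `zero`.
  layered-tail-avoids : ∀ {k I₀ B} {Bs : Vec (Subset size) k} →
                        IsLayered (B ∷ Bs) → Avoids I₀ (B ∷ Bs) → Avoids (I₀ ∪↓ B) Bs
  layered-tail-avoids layered avoids i p∈ p∈I with ∈-∪↓⁻ p∈I
  ... | inj₁ p∈I₀            = avoids (suc i) p∈ p∈I₀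
  ... | inj₂ (q , q∈B , p≼q) with () ← proj₁ (layered (suc i) zero _ q p∈ q∈B z≤n p≼q)

  layered-tail : ∀ {k B} {Bs : Vec (Subset size) k} → IsLayered (B ∷ Bs) → IsLayered Bs
  layered-tail layered i j p q p∈ q∈ j≤i p≼q
    with refl , p≡q ← layered (suc i) (suc j) p q p∈ q∈ (s≤s j≤i) p≼q = refl , p≡q

  hulls-chain : ∀ {k I₀} {Bs : Vec (Subset size) k} → IsIdeal Q I₀ → IsIdealChain (I₀ ∷ hulls I₀ Bs)
  hulls-chain {Bs = []}     I₀-ideal = I₀-ideal ∷ [] , [-]
  hulls-chain {Bs = B ∷ Bs} I₀-ideal with hulls-chain {Bs = Bs} (∪↓-isIdeal {B = B} I₀-ideal)
  ... | ideals , linked = I₀-ideal ∷ ideals , (λ p∈ → ∈-∪↓⁺ (inj₁ p∈)) ∷ linked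

  layers-hulls : ∀ {k I₀} {Bs : Vec (Subset size) k} → IsIdeal Q I₀ → IsLayered Bs → Avoids I₀ Bs →
                 layers I₀ (hulls I₀ Bs) ≡ Bs
  layers-hulls {Bs = []}     _        _       _      = refl
  layers-hulls {Bs = B ∷ Bs} I₀-ideal layered avoids = cong₂ _∷_
    -- Layeredness within the single layer `zero` says that `B` is an antichain.
    (max─-∪↓ I₀-ideal (λ p q p∈ q∈ p≼q → proj₂ (layered zero zero p q p∈ q∈ z≤n p≼q)) (avoids zero))
    (layers-hulls (∪↓-isIdeal I₀-ideal) (layered-tail layered) (layered-tail-avoids layered avoids))

  ⊥-isIdeal : IsIdeal Q ⊥
  ⊥-isIdeal i j i≼j j∈⊥ = contradiction j∈⊥ ∉⊥

  -- Realises the convention that the ideal with index 0 is empty, from which the inductions on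
  -- layers start.
  ⊥∷-chain : ∀ {k} {Is : Vec (Subset size) (suc k)} → IsIdealChain Is → IsIdealChain (⊥ ∷ Is)
  ⊥∷-chain (ideals , linked) = ⊥-isIdeal ∷ ideals , ⊥⊆ ∷ linked

  tail-chain : ∀ {k I₀} {Is : Vec (Subset size) (suc k)} → IsIdealChain (I₀ ∷ Is) → IsIdealChain Is
  tail-chain (_ ∷ ideals , _ ∷ linked) = ideals , linked

  ∈-ideals⁺ : ∀ {I} → IsIdeal Q I → I ∈ₗ ideals Q
  ∈-ideals⁺ = ∈-filter⁺ (isIdeal? Q) (∈-allSubsets _)

  ∈-ideals⁻ : ∀ {I} → I ∈ₗ ideals Q → IsIdeal Q I
  ∈-ideals⁻ = proj₂ ∘ ∈-filter⁻ (isIdeal? Q) {xs = allSubsets size}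

  ideals-unique : Unique (ideals Q)
  ideals-unique = Unique.filter⁺ (isIdeal? Q) (allSubsets-unique size)

  -- Enumeration of the chains of ideals

  module _ (k : ℕ) where

    -- The index set of the double sum over `I` and over the sequences ending in `I`, flattened into
    -- one list; `I` is appended as the last ideal.
    idealChains : List (Vec (Subset size) (suc k))
    idealChains = concatMap (λ I → map (_∷ʳ I) (idealSequences Q (suc k) I)) (ideals Q)

    linked-∷ʳ? : ∀ I → Decidable λ (Is : Vec (Subset size) k) → Linked _⊆_ (Is ∷ʳ I)
    linked-∷ʳ? I Is = linked? _⊆?_ (Is ∷ʳ I)

    idealChains-unique : Unique idealChains
    idealChains-unique = Unique.concat⁺
      (All.map⁺ (All.universal (λ I → Unique.map⁺ (∷ʳ-injectiveˡ _ _)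
        (Unique.filter⁺ (linked-∷ʳ? I) (tuples-unique ideals-unique k))) _))
      (AllPairs.map⁺ (AllPairs.map disjoint ideals-unique))
      where
      disjoint : ∀ {I J} → I ≢ J → ∀ {Is} →
        ¬ (Is ∈ₗ map (_∷ʳ I) (idealSequences Q (suc k) I) ×
           Is ∈ₗ map (_∷ʳ J) (idealSequences Q (suc k) J))
      disjoint I≢J (Is∈ , Is∈′) with ∈-map⁻ _ Is∈ | ∈-map⁻ _ Is∈′
      -- A chain determines its last entry, so blocks for different `I` share no chain.
      ... | Js , _ , refl | Js′ , _ , eq = I≢J (∷ʳ-injectiveʳ Js Js′ eq)

    ∈-idealChains⁺ : ∀ {Is} → IsIdealChain Is → Is ∈ₗ idealChains
    ∈-idealChains⁺ {Is} (Is-ideals , linked) with initLast Is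
    ... | Js , I , refl with Js-ideals , I-ideal ← All-∷ʳ⁻ Is-ideals =
      ∈-concatMap⁺ _ (Any.map
        (λ { refl → ∈-map⁺ (_∷ʳ I)
          (∈-filter⁺ (linked-∷ʳ? I) (∈-tuples⁺ (VAll.map ∈-ideals⁺ Js-ideals)) linked) })
        (∈-ideals⁺ I-ideal))

    ∈-idealChains⁻ : ∀ {Is} → Is ∈ₗ idealChains → IsIdealChain Is
    ∈-idealChains⁻ Is∈
      with I , I∈ , Is∈′ ←
        find (∈-concatMap⁻ (λ I → map (_∷ʳ I) (idealSequences Q (suc k) I)) {xs = ideals Q} Is∈)
      with Js , Js∈ , refl ← ∈-map⁻ (_∷ʳ I) Is∈′
      with Js∈′ , linked ← ∈-filter⁻ (linked-∷ʳ? I) {xs = tuples (ideals Q) k} Js∈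
      = All-∷ʳ⁺ (VAll.map ∈-ideals⁻ (∈-tuples⁻ Js∈′)) (∈-ideals⁻ I∈) , linked

  -- Antichains of the product

  module _ {k : ℕ} where

    private
      module P = FinitePoset ([ k ]ᶜ ×ᶠ Q)

    private
      _≼×_ : Fin k × Fin size → Fin k × Fin size → Set ℓ₂
      (i , p) ≼× (j , q) = i Fin.≤ j × p ≼ q

    -- The product order decodes both indices with `remQuot` and compares componentwise;
    -- `remQuot-combine` undoes the decoding.
    combine-≼⁺ : ∀ {i j p q} → i Fin.≤ j → p ≼ q → combine i p P.≼ combine j q
    combine-≼⁺ {i} {j} {p} {q} i≤j p≼q =
      subst₂ _≼×_ (sym (remQuot-combine i p)) (sym (remQuot-combine j q)) (i≤j , p≼q)

    combine-≼⁻ : ∀ i j {p q} → combine i p P.≼ combine j q → i Fin.≤ j × p ≼ q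
    combine-≼⁻ i j {p} {q} = subst₂ _≼×_ (remQuot-combine i p) (remQuot-combine j q)

    -- Layers are listed from the top of the chain, whereas `combine` numbers the blocks of size
    -- `size` from its bottom; hence the reversal.
    assemble : Vec (Subset size) k → Subset (k * size)
    assemble Bs = concat (reverse Bs)

    disassemble : Subset (k * size) → Vec (Subset size) k
    disassemble A = reverse (proj₁ (group k size A))

    assemble-disassemble : ∀ A → assemble (disassemble A) ≡ A
    assemble-disassemble A = trans
      (cong (concat {m = size} {n = k}) (reverse-involutive (proj₁ (group k size A))))
      (sym (proj₂ (group k size A)))

    disassemble-assemble : ∀ Bs → disassemble (assemble Bs) ≡ Bs
    disassemble-assemble Bs = trans
      (cong reverse (concat-injective (proj₁ (group k size (assemble Bs))) (reverse Bs) (sym (proj₂ (group k size (assemble Bs))))))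
      (reverse-involutive Bs)

    lookup-assemble : ∀ Bs i p → lookup (assemble Bs) (combine (opposite i) p) ≡ lookup (lookup Bs i) p
    lookup-assemble Bs i p =
      trans (lookup-concat (reverse Bs) (opposite i) p) (cong (λ B → lookup B p) (lookup-reverse Bs i))

    ∈-assemble⁺ : ∀ Bs i {p} → p ∈ lookup Bs i → combine (opposite i) p ∈ assemble Bs
    ∈-assemble⁺ Bs i {p} p∈ = lookup⇒[]= _ _ (trans (lookup-assemble Bs i p) ([]=⇒lookup p∈))

    ∈-assemble⁻ : ∀ Bs i {p} → combine (opposite i) p ∈ assemble Bs → p ∈ lookup Bs i
    ∈-assemble⁻ Bs i {p} p∈ = lookup⇒[]= _ _ (trans (sym (lookup-assemble Bs i p)) ([]=⇒lookup p∈))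

    -- Lets every element of the product be addressed by a layer index, so that antichains can be
    -- tested layer by layer.
    combine-opposite-surjective : ∀ x → ∃ λ i → ∃ λ p → x ≡ combine {k} {size} (opposite i) p
    combine-opposite-surjective x with i , p , refl ← combine-surjective {k} {size} x =
      opposite i , p , cong (λ i → combine i p) (sym (opposite-involutive i))

    -- As `opposite` reverses the order, comparability in the product means `j ≤ i` for the layer
    -- indices, the direction in which `IsLayered` is phrased.
    layered⇒antichain : ∀ Bs → IsLayered Bs → IsAntichain ([ k ]ᶜ ×ᶠ Q) (assemble Bs)
    layered⇒antichain Bs layered x y x∈ y∈ x≼y
      with i , p , refl ← combine-opposite-surjective x | j , q , refl ← combine-opposite-surjective y
      with i≥j , p≼q ← combine-≼⁻ (opposite i) (opposite j) x≼y
      with refl , refl ← layered i j p q (∈-assemble⁻ Bs i x∈) (∈-assemble⁻ Bs j y∈)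
                           (opposite-cancel-≤ i≥j) p≼q
      = refl

    antichain⇒layered : ∀ Bs → IsAntichain ([ k ]ᶜ ×ᶠ Q) (assemble Bs) → IsLayered Bs
    antichain⇒layered Bs antichain i j p q p∈ q∈ j≤i p≼q
      with eq₁ , eq₂ ← combine-injective _ p _ q
        (antichain _ _ (∈-assemble⁺ Bs i p∈) (∈-assemble⁺ Bs j q∈)
          (combine-≼⁺ (opposite-antitone j≤i) p≼q))
      -- Being an involution, `opposite` is injective.
      = trans (sym (opposite-involutive i)) (trans (cong opposite eq₁) (opposite-involutive j)) , eq₂

  -- The bijection between chains of ideals and antichains, and its exponents

  ∣assemble-layers∣ : ∀ {k} I₀ (Is : Vec (Subset size) k) → ∣ assemble (layers I₀ Is) ∣ ≡ exponentFrom Q I₀ Is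
  ∣assemble-layers∣ I₀ []       = refl
  ∣assemble-layers∣ I₀ (I ∷ Is) = begin
    ∣ concat (reverse ((max Q I ─ I₀) ∷ layers I Is)) ∣
      ≡⟨ cong (∣_∣ ∘ concat) (reverse-∷ _ (layers I Is)) ⟩
    ∣ concat (reverse (layers I Is) ∷ʳ (max Q I ─ I₀)) ∣
      ≡⟨ ∣concat-∷ʳ∣ (reverse (layers I Is)) _ ⟩
    ∣ max Q I ─ I₀ ∣ + ∣ assemble (layers I Is) ∣
      ≡⟨ cong (∣ max Q I ─ I₀ ∣ +_) (∣assemble-layers∣ I Is) ⟩
    ∣ max Q I ─ I₀ ∣ + exponentFrom Q I Is ∎
    where open ≡-Reasoning

  idealChains↭antichains : ∀ k → map (assemble ∘ layers ⊥) (idealChains k) ↭ antichains ([ suc k ]ᶜ ×ᶠ Q)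
  idealChains↭antichains k =
    bijection⇒↭ (assemble ∘ layers ⊥) (hulls ⊥ ∘ disassemble {suc k})
      (idealChains-unique k) (Unique.filter⁺ antichain? (allSubsets-unique _))
      to from
    where
    antichain? = isAntichain? ([ suc k ]ᶜ ×ᶠ Q)

    to : ∀ {Is} → Is ∈ₗ idealChains k →
         assemble (layers ⊥ Is) ∈ₗ antichains ([ suc k ]ᶜ ×ᶠ Q) ×
         hulls ⊥ (disassemble {suc k} (assemble (layers ⊥ Is))) ≡ Is
    to {Is} Is∈ with chain ← ⊥∷-chain (∈-idealChains⁻ k Is∈) =
      ∈-filter⁺ antichain? (∈-allSubsets _) (layered⇒antichain (layers ⊥ Is) (layers-layered chain)) ,
      trans (cong (hulls ⊥) (disassemble-assemble (layers ⊥ Is))) (hulls-layers chain)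

    from : ∀ {A} → A ∈ₗ antichains ([ suc k ]ᶜ ×ᶠ Q) →
           hulls ⊥ (disassemble {suc k} A) ∈ₗ idealChains k ×
           assemble (layers ⊥ (hulls ⊥ (disassemble {suc k} A))) ≡ A
    from {A} A∈ =
      -- `hulls-chain` includes the initial ideal `⊥`, which is not an entry of the chain and is
      -- dropped.
      ∈-idealChains⁺ k (tail-chain (hulls-chain {Bs = disassemble {suc k} A} ⊥-isIdeal)) ,
      -- The induction starts from the empty ideal, which all layers avoid trivially.
      trans (cong assemble (layers-hulls {Bs = disassemble A} ⊥-isIdeal layered (λ _ _ → ∉⊥)))
            (assemble-disassemble {suc k} A)
      where
      layered : IsLayered (disassemble {suc k} A)
      layered = antichain⇒layered (disassemble A)
        (subst (IsAntichain ([ suc k ]ᶜ ×ᶠ Q)) (sym (assemble-disassemble {suc k} A))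
          (proj₂ (∈-filter⁻ antichain? {xs = allSubsets _} A∈)))

mainTheorem2 : ∀ {c ℓ₁ ℓ₂} (Q : FinitePoset c ℓ₁ ℓ₂) → Connected Q → Graded Q →
    (k : ℕ) .{{_ : NonZero k}} →
    𝒩 ([ k ]ᶜ ×ᶠ Q) ≈ₚ (∑[ I ← ideals Q ] 𝒩ᴵ Q k I)
mainTheorem2 Q _ _ (suc k) m = begin
  coeff (sumOver (antichains ([ suc k ]ᶜ ×ᶠ Q)) (λ A → x^ ∣ A ∣)) m
    ≡⟨ sumOver-↭ (λ A → x^ ∣ A ∣) (idealChains↭antichains Q k) m ⟨
  coeff (sumOver (map (assemble Q ∘ layers Q ⊥) (idealChains Q k)) (λ A → x^ ∣ A ∣)) m
    ≡⟨ cong (λ p → coeff p m) (sumOver-map (assemble Q ∘ layers Q ⊥) (idealChains Q k) _) ⟩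
  coeff (sumOver (idealChains Q k) (λ Is → x^ ∣ assemble Q (layers Q ⊥ Is) ∣)) m
    ≡⟨ cong (λ p → coeff p m) (sumOver-cong (idealChains Q k) (cong x^_ ∘ ∣assemble-layers∣ Q ⊥)) ⟩
  coeff (sumOver (idealChains Q k) (λ Is → x^ exponentFrom Q ⊥ Is)) m
    -- The single sum over chains is split again according to the last ideal `I`.
    ≡⟨ sumOver-concatMap _ (ideals Q) _ m ⟩
  coeff (∑[ I ← ideals Q ] sumOver (map (_∷ʳ I) (idealSequences Q (suc k) I)) (λ Is → x^ exponentFrom Q ⊥ Is)) m
    ≡⟨ cong (λ p → coeff p m) (sumOver-cong (ideals Q) λ I →
         sumOver-map (_∷ʳ I) (idealSequences Q (suc k) I) _) ⟩
  coeff (∑[ I ← ideals Q ] 𝒩ᴵ Q (suc k) I) m ∎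
  where open ≡-Reasoning
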